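{- Let $\Delta$ be a formal definition, $\mathcal{O}$ a context structure of $\Delta$, and $\prec$ an order that strictly orders $\Delta$ in $\mathcal{O}$. Then terminal natural inductions of $\Delta$ in $\mathcal{O}$ that respect $\prec$ exist, and all of them converge to the same limit. Moreover, this limit is independent of $\prec$: if $\prec'$ also strictly orders $\Delta$ in $\mathcal{O}$, the terminal natural inductions respecting $\prec'$ have the same limit.
   Context: Formal definitions. A formal definition $\Delta$ is a set of rules $\forall\bar x\,(P(\bar t)\leftarrow\phi)$ with $\phi$ a first-order formula and $P(\bar t)$ an atomic formula whose predicate $P$ is not equality. Such a rule is shorthand for $\forall\bar y\,(P(\bar y)\leftarrow\exists\bar x(\bar y=\bar t\wedge\phi))$, so every rule is assumed of the form $\forall\bar x\,(P(\bar x)\leftarrow\phi)$ with $\bar x$ distinct variables. $\mathrm{def}(\Delta)$ is the set of predicates occurring in heads; $\mathrm{pars}(\Delta)$ is the set of all other non-logical symbols with free occurrences in $\Delta$. A context structure $\mathcal{O}$ of $\Delta$ is a $\mathrm{pars}(\Delta)$-structure; let $D$ be its domain. A defined domain atom is $P(\bar a)$ with $P\in\mathrm{def}(\Delta)$ of arity $n$ and $\bar a\in D^n$; $\mathrm{At}$ is the set of all of them. $\mathrm{def}(\Delta)$-structures with domain $D$ are identified with subsets of $\mathrm{At}$ (the set of their true atoms). $\mathfrak{A}\vdash_\Delta P(\bar a)$ ("$P(\bar a)$ is derivable from $\mathfrak{A}$") means that some rule $\forall\bar x(P(\bar x)\leftarrow\phi)$ of $\Delta$ has $\phi$ true for $\bar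 x:=\bar a$ in the structure combining $\mathcal{O}$ and $\mathfrak{A}$. $\mathfrak{A}$ is saturated (closed) on $S\subseteq\mathrm{At}$ if every $A\in S$ with $\mathfrak{A}\vdash_\Delta A$ belongs to $\mathfrak{A}$; $\mathfrak{A}$ is saturated if it is so on $\mathrm{At}$. Natural inductions. A natural induction of $\Delta$ in $\mathcal{O}$ is a $\subseteq$-increasing sequence $\mathcal{N}=(\mathfrak{A}_\alpha)_{0\le\alpha\le\beta}$ ($\beta$ an ordinal) of subsets of $\mathrm{At}$ with $\mathfrak{A}_0=\emptyset$; $\mathfrak{A}_i\vdash_\Delta A$ for every $i+1\le\beta$ and every $A\in\mathfrak{A}_{i+1}\setminus\mathfrak{A}_i$ (then $A$ is derived at stage $i$); and $\mathfrak{A}_\lambda=\bigcup_{\alpha<\lambda}\mathfrak{A}_\alpha$ for limit ordinals $\lambda\le\beta$. Its limit is $\mathfrak{A}_\beta$. It is terminal if its limit is saturated. Orders. A binary relation $\prec$ on $\mathrm{At}$ is a dependency relation of $\Delta$ in $\mathcal{O}$ if for all $A\in\mathrm{At}$ and all $\mathfrak{A},\mathfrak{B}\subseteq\mathrm{At}$ with $\mathfrak{A}\cap\{B:B\prec A\}=\mathfrak{B}\cap\{B:B\prec A\}$: $\mathfrak{A}\vdash_\Delta A$ iff $\mathfrak{B}\vdash_\Delta A$. $\prec$ strictly orders $\Delta$ in $\mathcal{O}$ if it is a strict well-founded order on $\mathrm{At}$ and a dependency relation of $\Delta$ in $\mathcal{O}$. A natural induction respects $\prec$ if whenever $A$ is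 derived at stage $i$, $\mathfrak{A}_i$ is saturated on $\{B:B\prec A\}$. -}

module Defs where

open import Level using (Level; suc; _⊔_)
open import Data.Nat using (ℕ) renaming (suc to 1+)
open import Data.Fin using (Fin)
open import Data.Vec using (Vec; []; _∷_; lookup)
open import Data.Vec.Relation.Unary.Any using (Any; here; there)
open import Data.Product using (Σ; ∃; _×_; _,_; proj₁; proj₂)
open import Data.Sum using (_⊎_; inj₁; inj₂)
open import Data.Empty.Polymorphic using (⊥)
open import Data.Unit.Polymorphic using (⊤)
open import Relation.Nullary using (¬_)
open import Relation.Unary
  using (Pred; _∈_; _∉_; _⊆_; _≐_; _∩_; _∖_; ⋃; Empty; U)
open import Relation.Binary
  using (Rel; StrictTotalOrder; IsStrictPartialOrder)
open import Relation.Binary.PropositionalEquality using (_≡_; refl)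
open import Induction.WellFounded using (WellFounded)

-- Universe convention: Set ℓ plays the role of the universe of sets, so
-- vocabularies, domains, subsets and ordinals all live at one level ℓ.

-- Object constants are function symbols of arity 0.
record Vocabulary (ℓ : Level) : Set (suc ℓ) where
  field
    Predicate : Set ℓ
    Function  : Set ℓ
    arityₚ    : Predicate → ℕ
    arityₓ    : Function → ℕ

  Symbol : Set ℓ
  Symbol = Predicate ⊎ Function

module _ {ℓ : Level} (V : Vocabulary ℓ) where
  open Vocabulary V

  data Term (n : ℕ) : Set ℓ where
    var : Fin n → Term n
    fun : (f : Function) → Vec (Term n) (arityₓ f) → Term n

  -- Formula n has its free variables among n de Bruijn variables; a
  -- quantifier binds variable 0.
  data Formula (n : ℕ) : Set ℓ where
    ⊤′ ⊥′          : Formula n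
    _≈′_           : Term n → Term n → Formula n
    rel            : (P : Predicate) → Vec (Term n) (arityₚ P) → Formula n
    ¬′_            : Formula n → Formula n
    _∧′_ _∨′_ _⇒′_ : Formula n → Formula n → Formula n
    ∀′_ ∃′_        : Formula (1+ n) → Formula n

  -- The rule ∀ x̄ (P(x̄) ← φ), with x̄ distinct variables.
  record Rule : Set ℓ where
    constructor rule
    field
      head : Predicate
      body : Formula (arityₚ head)

  FormalDefinition : Set (suc ℓ)
  FormalDefinition = Pred Rule ℓ

module _ {ℓ : Level} {V : Vocabulary ℓ} where
  open Vocabulary V

  data _occursInₜ_ {n : ℕ} (s : Symbol) : Term V n → Set ℓ where
    here : ∀ {f ts} → s ≡ inj₂ f → s occursInₜ fun f ts
    args : ∀ {f ts} → Any (s occursInₜ_) ts → s occursInₜ fun f ts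

  data _occursIn_ (s : Symbol) : {n : ℕ} → Formula V n → Set ℓ where
    ≈ˡ  : ∀ {n} {t u : Term V n} → s occursInₜ t → s occursIn (t ≈′ u)
    ≈ʳ  : ∀ {n} {t u : Term V n} → s occursInₜ u → s occursIn (t ≈′ u)
    relₕ : ∀ {n P} {ts : Vec (Term V n) (arityₚ P)} →
           s ≡ inj₁ P → s occursIn rel P ts
    relₐ : ∀ {n P} {ts : Vec (Term V n) (arityₚ P)} →
           Any (s occursInₜ_) ts → s occursIn rel P ts
    ¬ᵒ  : ∀ {n} {φ : Formula V n} → s occursIn φ → s occursIn (¬′ φ)
    ∧ˡ  : ∀ {n} {φ ψ : Formula V n} → s occursIn φ → s occursIn (φ ∧′ ψ)
    ∧ʳ  : ∀ {n} {φ ψ : Formula V n} → s occursIn ψ → s occursIn (φ ∧′ ψ)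
    ∨ˡ  : ∀ {n} {φ ψ : Formula V n} → s occursIn φ → s occursIn (φ ∨′ ψ)
    ∨ʳ  : ∀ {n} {φ ψ : Formula V n} → s occursIn ψ → s occursIn (φ ∨′ ψ)
    ⇒ˡ  : ∀ {n} {φ ψ : Formula V n} → s occursIn φ → s occursIn (φ ⇒′ ψ)
    ⇒ʳ  : ∀ {n} {φ ψ : Formula V n} → s occursIn ψ → s occursIn (φ ⇒′ ψ)
    ∀ᵒ  : ∀ {n} {φ : Formula V (1+ n)} → s occursIn φ → s occursIn (∀′ φ)
    ∃ᵒ  : ∀ {n} {φ : Formula V (1+ n)} → s occursIn φ → s occursIn (∃′ φ)

  def : FormalDefinition V → Pred Symbol ℓ
  def Δ s = ∃ λ r → r ∈ Δ × s ≡ inj₁ (Rule.head r)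

  voc : FormalDefinition V → Pred Symbol ℓ
  voc Δ s = ∃ λ r → r ∈ Δ × (s ≡ inj₁ (Rule.head r) ⊎ s occursIn Rule.body r)

  -- Quantifiers only bind variables, so every occurrence of a symbol is free.
  pars : FormalDefinition V → Pred Symbol ℓ
  pars Δ = voc Δ ∖ def Δ

-- An S-structure interprets exactly the symbols in S.  Membership proofs
-- are irrelevant so that a symbol has a single interpretation.
record Structure {ℓ} (V : Vocabulary ℓ) (S : Pred (Vocabulary.Symbol V) ℓ)
                 : Set (suc ℓ) where
  open Vocabulary V
  field
    Domain   : Set ℓ
    function : ∀ f → .(inj₂ f ∈ S) → Vec Domain (arityₓ f) → Domain
    relation : ∀ P → .(inj₁ P ∈ S) → Pred (Vec Domain (arityₚ P)) ℓ

module _ {ℓ : Level} {V : Vocabulary ℓ} {S : Pred (Vocabulary.Symbol V) ℓ}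
         (𝔐 : Structure V S) where
  open Structure 𝔐

  mutual
    eval : ∀ {n} (t : Term V n) → (_occursInₜ t) ⊆ S → Vec Domain n → Domain
    eval (var x)    _ ρ = lookup ρ x
    eval (fun f ts) o ρ = function f (o (here refl))
                            (evals ts (λ p → o (args p)) ρ)

    evals : ∀ {n k} (ts : Vec (Term V n) k) →
            (λ s → Any (s occursInₜ_) ts) ⊆ S → Vec Domain n → Vec Domain k
    evals []       _ _ = []
    evals (t ∷ ts) o ρ = eval t (λ p → o (here p)) ρ
                       ∷ evals ts (λ p → o (there p)) ρ

  Sat : ∀ {n} (φ : Formula V n) → (_occursIn φ) ⊆ S → Pred (Vec Domain n) ℓ
  Sat ⊤′         _ _ = ⊤
  Sat ⊥′         _ _ = ⊥
  Sat (t ≈′ u)   o ρ = eval t (λ p → o (≈ˡ p)) ρ ≡ eval u (λ p → o (≈ʳ p)) ρ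
  Sat (rel P ts) o ρ = relation P (o (relₕ refl))
                         (evals ts (λ p → o (relₐ p)) ρ)
  Sat (¬′ φ)     o ρ = ¬ Sat φ (λ p → o (¬ᵒ p)) ρ
  Sat (φ ∧′ ψ)   o ρ = Sat φ (λ p → o (∧ˡ p)) ρ × Sat ψ (λ p → o (∧ʳ p)) ρ
  Sat (φ ∨′ ψ)   o ρ = Sat φ (λ p → o (∨ˡ p)) ρ ⊎ Sat ψ (λ p → o (∨ʳ p)) ρ
  Sat (φ ⇒′ ψ)   o ρ = Sat φ (λ p → o (⇒ˡ p)) ρ → Sat ψ (λ p → o (⇒ʳ p)) ρ
  Sat (∀′ φ)     o ρ = ∀ d → Sat φ (λ p → o (∀ᵒ p)) (d ∷ ρ)
  Sat (∃′ φ)     o ρ = ∃ λ d → Sat φ (λ p → o (∃ᵒ p)) (d ∷ ρ)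

-- The set {α : α ≤ β} for an ordinal β: a well-ordered set with a greatest
-- element, taken up to its setoid equality since there are no quotients.
record OrdinalsUpTo (ℓ : Level) : Set (suc ℓ) where
  field
    strictTotalOrder : StrictTotalOrder ℓ ℓ ℓ

  open StrictTotalOrder strictTotalOrder public
    using (_≈_; _<_) renaming (Carrier to Index)

  _≤_ : Rel Index ℓ
  i ≤ j = i < j ⊎ i ≈ j

  field
    <-wellFounded : WellFounded _<_
    β             : Index
    ≤β            : ∀ i → i ≤ β

  IsZero : Pred Index ℓ
  IsZero i = ∀ j → ¬ (j < i)

  -- j = i + 1
  _IsSuccessorOf_ : Rel Index ℓ
  j IsSuccessorOf i = i < j × (∀ k → ¬ (i < k × k < j))

  IsLimit : Pred Index ℓ
  IsLimit l = ¬ IsZero l × (∀ i → ¬ (l IsSuccessorOf i))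

module _ {ℓ : Level} {V : Vocabulary ℓ} (Δ : FormalDefinition V) where
  open Vocabulary V

  ContextStructure : Set (suc ℓ)
  ContextStructure = Structure V (pars Δ)

  module _ (𝒪 : ContextStructure) where
    open Structure 𝒪

    -- The field defined is irrelevant so that P(ā) is a single atom even
    -- when several rules define P.
    record At : Set ℓ where
      constructor atom
      field
        predicate : Predicate
        .defined  : inj₁ predicate ∈ def Δ
        arguments : Vec Domain (arityₚ predicate)

    -- 𝒪 interprets the parameters and 𝔄 the defined predicates.  The two
    -- disjuncts below are exclusive; function symbols are never defined.
    combine : Pred At ℓ → Structure V (voc Δ)
    combine 𝔄 = record
      { Domain   = Domain
      ; function = λ f v → function f (v , λ { (_ , _ , ()) })
      ; relation = λ P _ ā →
          (Σ (inj₁ P ∈ def Δ) λ d → atom P d ā ∈ 𝔄)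
          ⊎ (Σ (inj₁ P ∈ pars Δ) λ p → relation P p ā)
      }

    infix 4 _⊢_
    _⊢_ : Pred At ℓ → At → Set ℓ
    𝔄 ⊢ atom P _ ā =
      Σ (Formula V (arityₚ P)) λ φ →
      Σ (rule P φ ∈ Δ) λ r∈Δ →
        Sat (combine 𝔄) φ (λ o → rule P φ , r∈Δ , inj₂ o) ā

    SaturatedOn : ∀ {s} → Pred At s → Pred At ℓ → Set (s ⊔ ℓ)
    SaturatedOn S 𝔄 = ∀ A → A ∈ S → 𝔄 ⊢ A → A ∈ 𝔄

    Saturated : Pred At ℓ → Set ℓ
    Saturated = SaturatedOn U

    record NaturalInduction : Set (suc ℓ) where
      field
        ordinals : OrdinalsUpTo ℓ

      open OrdinalsUpTo ordinals public

      field
        𝔄 : Index → Pred At ℓ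

      DerivedAt : Index → Pred At ℓ
      DerivedAt i A = ∃ λ j → j IsSuccessorOf i × A ∈ 𝔄 j × A ∉ 𝔄 i

      field
        increasing : ∀ {i j} → i ≤ j → 𝔄 i ⊆ 𝔄 j
        zero       : ∀ {i} → IsZero i → Empty (𝔄 i)
        successor  : ∀ {i A} → A ∈ DerivedAt i → 𝔄 i ⊢ A
        limitStage : ∀ {l} → IsLimit l →
                     𝔄 l ≐ ⋃ (∃ λ α → α < l) (λ α → 𝔄 (proj₁ α))

      limit : Pred At ℓ
      limit = 𝔄 β

    Terminal : Pred NaturalInduction ℓ
    Terminal 𝒩 = Saturated (NaturalInduction.limit 𝒩)

    Respects : Rel At ℓ → Pred NaturalInduction ℓ
    Respects _≺_ 𝒩 = ∀ i A → A ∈ DerivedAt i → SaturatedOn (_≺ A) (𝔄 i)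
      where open NaturalInduction 𝒩

    DependencyRelation : Rel At ℓ → Set (suc ℓ)
    DependencyRelation _≺_ =
      ∀ A (𝔄 𝔅 : Pred At ℓ) → 𝔄 ∩ (_≺ A) ≐ 𝔅 ∩ (_≺ A) →
      (𝔄 ⊢ A → 𝔅 ⊢ A) × (𝔅 ⊢ A → 𝔄 ⊢ A)

    StrictlyOrders : Rel At ℓ → Set (suc ℓ)
    StrictlyOrders _≺_ =
      (IsStrictPartialOrder _≡_ _≺_ × WellFounded _≺_) × DependencyRelation _≺_

module Submission where

-- Call a set of atoms a fixpoint when its members are exactly the atoms
-- derivable from it, a notion that mentions no order.  The theorem follows
-- from three facts.
--
-- Fixpoints are unique (fixpoint-unique).  If two fixpoints agree strictly
-- below A, then by dependency A is derivable from one iff it is derivable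
-- from the other, so they agree on A; this is well-founded induction on ≺.
--
-- The limit of a terminal natural induction that respects ≺ is a fixpoint
-- (limit-fixpoint).  Saturation is half of this.  For the other half, an
-- atom A of the limit enters at a successor step, so it is derived from a
-- stage saturated below A (derived-at-stage).  By induction on ≺, that stage
-- and the limit agree below A, so A is derivable from the limit as well.
-- With uniqueness, all such limits coincide, also for two different orders.
--
-- For existence, well-founded recursion on ≺ gives a fixpoint, its defining
-- clause being that A belongs to it iff A is derivable from its restriction
-- to the atoms below A.  Atoms are compared by their ≺-rank, which makes them
-- a well-ordered set up to equality of ranks, and a greatest element is
-- added.  The stage at i consists of the atoms of the fixpoint of rank less
-- than i.  If A has rank i, this stage contains every atom of the fixpoint
-- below A, so it derives A and is saturated below A.

open import Defs
open import Axiom.ExcludedMiddle using (ExcludedMiddle)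
open import Axiom.DoubleNegationElimination using (em⇒dne)
open import Data.Empty using (⊥-elim)
open import Data.Product using (∃; _×_; _,_; proj₁; proj₂; swap)
open import Data.Sum using (_⊎_; inj₁; inj₂)
open import Data.Unit using (tt)
open import Induction.WellFounded using (Acc; acc; WellFounded; module All)
open import Relation.Binary
  using (Rel; StrictTotalOrder; IsStrictPartialOrder; tri<; tri≈; tri>)
open import Relation.Binary.Construct.Add.Supremum.Equality using (⊤⁺≈⊤⁺)
open import Relation.Binary.Construct.Add.Supremum.Strict
  using (_<⁺_; [_]; [_]<⊤⁺; <⁺-isStrictTotalOrder)
open import Relation.Nullary using (¬_; yes; no)
open import Relation.Nullary.Construct.Add.Supremum using (⊤⁺; [_])
open import Relation.Unary using (Pred; _∈_; _⊆_; _≐_)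

-- Ranks of the elements of a well-founded relation

module Rank {ℓ} (em : ExcludedMiddle ℓ) {X : Set ℓ}
            (_≺_ : Rel X ℓ) (≺-wf : WellFounded _≺_) where

  infix 4 _≲_ _⋖_

  -- x ≲ y says that the rank of x, the ordinal sup {rank z + 1 : z ≺ x}, is
  -- at most that of y.  The clause is the recursive characterisation of this
  -- comparison, so that no ordinals are needed to state it.
  data _≲_ (x y : X) : Set ℓ where
    below : (∀ {z} → z ≺ x → ∃ λ w → w ≺ y × z ≲ w) → x ≲ y

  -- The rank of x is less than that of y.
  _⋖_ : Rel X ℓ
  x ⋖ y = ∃ λ w → w ≺ y × x ≲ w

  -- Equality of ranks.
  _≋_ : Rel X ℓ
  x ≋ y = x ≲ y × y ≲ x

  ≲-refl : ∀ {x} → x ≲ x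
  ≲-refl {x} = All.wfRec ≺-wf ℓ (λ x → x ≲ x)
                 (λ x rec → below λ z≺x → _ , z≺x , rec z≺x) x

  ≲-trans : ∀ {x y z} → x ≲ y → y ≲ z → x ≲ z
  ≲-trans (below f) (below g) = below λ x′≺x →
    let (_ , y′≺y , x′≲y′) = f x′≺x
        (_ , z′≺z , y′≲z′) = g y′≺y
    in _ , z′≺z , ≲-trans x′≲y′ y′≲z′

  ≺⇒⋖ : ∀ {x y} → x ≺ y → x ⋖ y
  ≺⇒⋖ x≺y = _ , x≺y , ≲-refl

  ≲-⋖-trans : ∀ {x y z} → x ≲ y → y ⋖ z → x ⋖ z
  ≲-⋖-trans x≲y (_ , w≺z , y≲w) = _ , w≺z , ≲-trans x≲y y≲w

  ⋖-≲-trans : ∀ {x y z} → x ⋖ y → y ≲ z → x ⋖ z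
  ⋖-≲-trans (_ , w≺y , x≲w) (below f) = ≲-⋖-trans x≲w (f w≺y)

  ⋖⇒≲ : ∀ {x y} → x ⋖ y → x ≲ y
  ⋖⇒≲ (_ , w≺y , below f) = below λ z≺x → _ , w≺y , ⋖⇒≲ (f z≺x)

  ⋖-trans : ∀ {x y z} → x ⋖ y → y ⋖ z → x ⋖ z
  ⋖-trans x⋖y y⋖z = ⋖-≲-trans x⋖y (⋖⇒≲ y⋖z)

  ⋖-wellFounded : WellFounded _⋖_
  ⋖-wellFounded y = ≲-acc (≺-wf y) ≲-refl
    where
    ≲-acc : ∀ {x y} → Acc _≺_ y → x ≲ y → Acc _⋖_ x
    ≲-acc (acc rs) x≲y = acc λ z⋖x →
      let (_ , w≺y , z≲w) = ⋖-≲-trans z⋖x x≲y in ≲-acc (rs w≺y) z≲w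

  ⋖-irrefl : ∀ {x} → ¬ (x ⋖ x)
  ⋖-irrefl {x} = All.wfRec ⋖-wellFounded ℓ (λ x → ¬ (x ⋖ x))
                   (λ x rec x⋖x → rec x⋖x x⋖x) x

  ≲⇒¬⋗ : ∀ {x y} → x ≲ y → ¬ (y ⋖ x)
  ≲⇒¬⋗ x≲y y⋖x = ⋖-irrefl (≲-⋖-trans x≲y y⋖x)

  -- Comparability of ranks.  Either some z ≺ x has rank greater than every
  -- w ≺ y, so that y ≲ z, or each z ≺ x has rank at most that of some w ≺ y.
  ≲-or-⋗ : ∀ x y → x ≲ y ⊎ y ⋖ x
  ≲-or-⋗ x = All.wfRec ≺-wf ℓ (λ x → ∀ y → x ≲ y ⊎ y ⋖ x) step x
    where
    step : ∀ x → (∀ {z} → z ≺ x → ∀ y → z ≲ y ⊎ y ⋖ z) →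
           ∀ y → x ≲ y ⊎ y ⋖ x
    step x rec y with em {∃ λ z → z ≺ x × (∀ {w} → w ≺ y → w ⋖ z)}
    ... | yes (z , z≺x , y⊆z) =
      inj₂ (z , z≺x , below λ w≺y → y⊆z w≺y)
    ... | no ∄z = inj₁ (below λ {z} z≺x → em⇒dne em λ ∄w →
      ∄z (z , z≺x , λ {w} w≺y → exceeds z≺x λ z≲w → ∄w (w , w≺y , z≲w)))
      where
      exceeds : ∀ {z w} → z ≺ x → ¬ (z ≲ w) → w ⋖ z
      exceeds {w = w} z≺x z≴w with rec z≺x w
      ... | inj₁ z≲w = ⊥-elim (z≴w z≲w)
      ... | inj₂ w⋖z = w⋖z

  ⋖-strictTotalOrder : StrictTotalOrder ℓ ℓ ℓ
  ⋖-strictTotalOrder = record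
    { Carrier = X
    ; _≈_     = _≋_
    ; _<_     = _⋖_
    ; isStrictTotalOrder = record
      { isStrictPartialOrder = record
        { isEquivalence = record
          { refl  = ≲-refl , ≲-refl
          ; sym   = swap
          ; trans = λ (x≲y , y≲x) (y≲z , z≲y) → ≲-trans x≲y y≲z , ≲-trans z≲y y≲x
          }
        ; irrefl   = λ (_ , y≲x) x⋖y → ≲⇒¬⋗ y≲x x⋖y
        ; trans    = ⋖-trans
        ; <-resp-≈ = (λ (y≲z , _) x⋖y → ⋖-≲-trans x⋖y y≲z)
                   , (λ (_ , z≲y) y⋖x → ≲-⋖-trans z≲y y⋖x)
        }
      ; compare = compare
      }
    }
    where
    compare : ∀ x y → _
    compare x y with ≲-or-⋗ x y | ≲-or-⋗ y x
    ... | inj₁ x≲y | inj₁ y≲x = tri≈ (≲⇒¬⋗ y≲x) (x≲y , y≲x) (≲⇒¬⋗ x≲y)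
    ... | inj₁ x≲y | inj₂ x⋖y = tri< x⋖y (λ (_ , y≲x) → ≲⇒¬⋗ y≲x x⋖y) (≲⇒¬⋗ x≲y)
    ... | inj₂ y⋖x | inj₁ y≲x = tri> (≲⇒¬⋗ y≲x) (λ (x≲y , _) → ≲⇒¬⋗ x≲y y⋖x) y⋖x
    ... | inj₂ y⋖x | inj₂ x⋖y = ⊥-elim (⋖-irrefl (⋖-trans x⋖y y⋖x))

-- Adding a greatest element to a well-order

module _ {ℓ} (O : StrictTotalOrder ℓ ℓ ℓ) where
  open StrictTotalOrder O

  <⁺-acc : ∀ {k} → Acc _<_ k → Acc (_<⁺_ _<_) [ k ]
  <⁺-acc (acc rs) = acc λ { [ l<k ] → <⁺-acc (rs l<k) }

  <⁺-wellFounded : WellFounded _<_ → WellFounded (_<⁺_ _<_)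
  <⁺-wellFounded wf ⊤⁺    = acc λ { [ k ]<⊤⁺ → <⁺-acc (wf k) }
  <⁺-wellFounded wf [ k ] = <⁺-acc (wf k)

  -- The ordinals up to the order type of O: the elements of O stand for the
  -- smaller ones, and the added element for the order type itself.
  ordinalsUpTo : WellFounded _<_ → OrdinalsUpTo ℓ
  ordinalsUpTo wf = record
    { strictTotalOrder = record
      { isStrictTotalOrder = <⁺-isStrictTotalOrder _<_ isStrictTotalOrder }
    ; <-wellFounded = <⁺-wellFounded wf
    ; β             = ⊤⁺
    ; ≤β            = λ { ⊤⁺ → inj₂ ⊤⁺≈⊤⁺ ; [ k ] → inj₁ [ k ]<⊤⁺ }
    }

-- Fixpoints of derivability

module _ {ℓ} {V : Vocabulary ℓ} (Δ : FormalDefinition V)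
         (𝒪 : ContextStructure Δ) where

  private
    Atom : Set ℓ
    Atom = At Δ 𝒪

    infix 4 _⊩_
    _⊩_ : Pred Atom ℓ → Atom → Set ℓ
    _⊩_ = _⊢_ Δ 𝒪

  -- The members of 𝔄 are exactly the atoms derivable from 𝔄.
  Fixpoint : Pred (Pred Atom ℓ) ℓ
  Fixpoint 𝔄 = (∀ {A} → A ∈ 𝔄 → 𝔄 ⊩ A) × (∀ {A} → 𝔄 ⊩ A → A ∈ 𝔄)

  module Dependency {_≺_ : Rel Atom ℓ} (so : StrictlyOrders Δ 𝒪 _≺_) where

    ≺-wf : WellFounded _≺_
    ≺-wf = proj₂ (proj₁ so)

    ≺-trans : ∀ {A B C} → A ≺ B → B ≺ C → A ≺ C
    ≺-trans = IsStrictPartialOrder.trans (proj₁ (proj₁ so))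

    -- Derivability of A depends only on the atoms below A.
    transfer : ∀ {A} {𝔄 𝔅 : Pred Atom ℓ} →
               (∀ {B} → B ≺ A → (B ∈ 𝔄 → B ∈ 𝔅) × (B ∈ 𝔅 → B ∈ 𝔄)) →
               (𝔄 ⊩ A → 𝔅 ⊩ A) × (𝔅 ⊩ A → 𝔄 ⊩ A)
    transfer {A} {𝔄} {𝔅} agree = proj₂ so A 𝔄 𝔅
      ( (λ (B∈𝔄 , B≺A) → proj₁ (agree B≺A) B∈𝔄 , B≺A)
      , (λ (B∈𝔅 , B≺A) → proj₂ (agree B≺A) B∈𝔅 , B≺A))

    fixpoint-unique : ∀ {𝔄 𝔅 : Pred Atom ℓ} → Fixpoint 𝔄 → Fixpoint 𝔅 → 𝔄 ≐ 𝔅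
    fixpoint-unique {𝔄} {𝔅} (𝔄-sup , 𝔄-sat) (𝔅-sup , 𝔅-sat) =
      (λ {A} → proj₁ (agree A)) , (λ {A} → proj₂ (agree A))
      where
      agree : ∀ A → (A ∈ 𝔄 → A ∈ 𝔅) × (A ∈ 𝔅 → A ∈ 𝔄)
      agree = All.wfRec ≺-wf ℓ _ λ A rec →
        let (to , from) = transfer {𝔄 = 𝔄} {𝔅 = 𝔅} rec
        in (λ A∈𝔄 → 𝔅-sat (to (𝔄-sup A∈𝔄))) , (λ A∈𝔅 → 𝔄-sat (from (𝔅-sup A∈𝔅)))

    -- The canonical fixpoint, by recursion on accessibility: A is a member
    -- iff A is derivable from the set of members below A.
    mutual
      Canonical′ : ∀ {A} → Acc _≺_ A → Set ℓ
      Canonical′ {A} (acc rs) = CanonicalBelow rs ⊩ A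

      CanonicalBelow : ∀ {A} → (∀ {B} → B ≺ A → Acc _≺_ B) → Pred Atom ℓ
      CanonicalBelow {A} rs B = ∃ λ (B≺A : B ≺ A) → Canonical′ (rs B≺A)

    -- Membership does not depend on the accessibility proof.  Dependency
    -- gives this up to logical equivalence, without function extensionality.
    Canonical′-irrelevant : ∀ {A} (p q : Acc _≺_ A) → Canonical′ p → Canonical′ q
    Canonical′-irrelevant {A} (acc rs) (acc rs′) =
      proj₁ (transfer {A} {CanonicalBelow rs} {CanonicalBelow rs′} λ _ →
          (λ (B≺A , c) → B≺A , Canonical′-irrelevant (rs B≺A) (rs′ B≺A) c)
        , (λ (B≺A , c) → B≺A , Canonical′-irrelevant (rs′ B≺A) (rs B≺A) c))

    Canonical : Pred Atom ℓ
    Canonical A = Canonical′ (≺-wf A)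

    canonical-fixpoint : Fixpoint Canonical
    canonical-fixpoint =
      (λ {A} → proj₁ (unfold (≺-wf A))) , (λ {A} → proj₂ (unfold (≺-wf A)))
      where
      unfold : ∀ {A} (p : Acc _≺_ A) →
               (Canonical′ p → Canonical ⊩ A) × (Canonical ⊩ A → Canonical′ p)
      unfold (acc rs) = transfer λ {B} B≺A →
          (λ (B≺A , c) → Canonical′-irrelevant (rs B≺A) (≺-wf B) c)
        , (λ c → B≺A , Canonical′-irrelevant (≺-wf B) (rs B≺A) c)

  -- Limits of natural inductions

  module Limit (em : ExcludedMiddle ℓ) (𝒩 : NaturalInduction Δ 𝒪) where
    open NaturalInduction 𝒩

    -- Every atom of a stage is derived at some stage, because the least
    -- stage containing it is neither zero nor a limit.
    derived-at-stage : ∀ {A} i → A ∈ 𝔄 i → ∃ λ k → A ∈ DerivedAt k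
    derived-at-stage {A} = All.wfRec <-wellFounded ℓ _ step
      where
      step : ∀ i → (∀ {j} → j < i → A ∈ 𝔄 j → ∃ λ k → A ∈ DerivedAt k) →
             A ∈ 𝔄 i → ∃ λ k → A ∈ DerivedAt k
      step i rec A∈𝔄i with em {∃ λ j → j < i × A ∈ 𝔄 j}
      ... | yes (j , j<i , A∈𝔄j) = rec j<i A∈𝔄j
      ... | no  minimal with em {∃ λ k → i IsSuccessorOf k}
      ...   | yes (k , i=k+1) =
        k , i , i=k+1 , A∈𝔄i , λ A∈𝔄k → minimal (k , proj₁ i=k+1 , A∈𝔄k)
      ...   | no  ¬suc =
        let ((j , j<i) , A∈𝔄j) =
              proj₁ (limitStage ((λ isZero → zero isZero A A∈𝔄i)
                                , λ k i=k+1 → ¬suc (k , i=k+1))) A∈𝔄i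
        in ⊥-elim (minimal (j , j<i , A∈𝔄j))

    limit-fixpoint : ∀ {_≺_ : Rel Atom ℓ} → StrictlyOrders Δ 𝒪 _≺_ →
                     𝒩 ∈ Terminal Δ 𝒪 → 𝒩 ∈ Respects Δ 𝒪 _≺_ → Fixpoint limit
    limit-fixpoint {_≺_} so terminal respects =
      (λ {A} → supported A) , (λ {A} → terminal A tt)
      where
      open Dependency so

      supported : ∀ A → A ∈ limit → limit ⊩ A
      supported = All.wfRec ≺-wf ℓ _ step
        where
        step : ∀ A → (∀ {B} → B ≺ A → B ∈ limit → limit ⊩ B) →
               A ∈ limit → limit ⊩ A
        step A rec A∈limit =
          proj₁ (transfer λ {B} B≺A → 𝔄k⊆limit , complete B B≺A)
                (successor A-derived)
          where
          k         = proj₁ (derived-at-stage β A∈limit)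
          A-derived = proj₂ (derived-at-stage β A∈limit)

          𝔄k⊆limit : 𝔄 k ⊆ limit
          𝔄k⊆limit = increasing (≤β k)

          -- By an inner induction on B, stage k contains every atom B of the
          -- limit below A: the limit derives B, so stage k derives it,
          -- and stage k is saturated below A.
          complete : ∀ B → B ≺ A → B ∈ limit → B ∈ 𝔄 k
          complete = All.wfRec ≺-wf ℓ _ λ B complete-below B≺A B∈limit →
            respects k A A-derived B B≺A
              (proj₂ (transfer λ C≺B →
                        𝔄k⊆limit , complete-below C≺B (≺-trans C≺B B≺A))
                     (rec B≺A B∈limit))

  -- Existence of a terminal natural induction respecting the order

  module Existence (em : ExcludedMiddle ℓ) {_≺_ : Rel Atom ℓ}
                   (so : StrictlyOrders Δ 𝒪 _≺_) where
    open Dependency so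
    open Rank em _≺_ ≺-wf using (⋖-strictTotalOrder; ⋖-wellFounded; ≺⇒⋖)

    ordinals : OrdinalsUpTo ℓ
    ordinals = ordinalsUpTo ⋖-strictTotalOrder ⋖-wellFounded

    open OrdinalsUpTo ordinals
    open StrictTotalOrder strictTotalOrder
      using (compare; <-respʳ-≈) renaming (trans to <-trans)

    supported : ∀ {A} → A ∈ Canonical → Canonical ⊩ A
    supported = proj₁ canonical-fixpoint

    saturated : ∀ {A} → Canonical ⊩ A → A ∈ Canonical
    saturated = proj₂ canonical-fixpoint

    -- The members of the fixpoint of rank less than i.
    Stage : Index → Pred Atom ℓ
    Stage i A = [ A ] < i × A ∈ Canonical

    stage-agrees : ∀ {i A} → (∀ {B} → B ≺ A → [ B ] < i) → ∀ {B} → B ≺ A →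
                   (B ∈ Stage i → B ∈ Canonical) × (B ∈ Canonical → B ∈ Stage i)
    stage-agrees below-i B≺A = proj₂ , (λ B∈C → below-i B≺A , B∈C)

    -- An atom that enters between i and i + 1 has rank i.
    new-below : ∀ {i j A} → j IsSuccessorOf i → A ∈ Stage j → ¬ (A ∈ Stage i) →
                ∀ {B} → B ≺ A → [ B ] < i
    new-below {i} {A = A} (_ , nothing-between) (A<j , A∈C) A∉Stage-i B≺A
      with compare [ A ] i
    ... | tri< A<i _ _ = ⊥-elim (A∉Stage-i (A<i , A∈C))
    ... | tri≈ _ A≈i _ = <-respʳ-≈ A≈i [ ≺⇒⋖ B≺A ]
    ... | tri> _ _ i<A = ⊥-elim (nothing-between [ A ] (i<A , A<j))

    stage-increasing : ∀ {i j} → i ≤ j → Stage i ⊆ Stage j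
    stage-increasing (inj₁ i<j) (A<i , A∈C) = <-trans A<i i<j , A∈C
    stage-increasing (inj₂ i≈j) (A<i , A∈C) = <-respʳ-≈ i≈j A<i , A∈C

    -- If l is not the successor of the rank of A < l, then some k lies
    -- strictly between, and A belongs to the stage at k.
    stage-limit : ∀ {l A} → IsLimit l → A ∈ Stage l → ∃ λ k → k < l × A ∈ Stage k
    stage-limit {A = A} (_ , ¬suc) (A<l , A∈C) = em⇒dne em λ ∄k →
      ¬suc [ A ] (A<l , λ k (A<k , k<l) → ∄k (k , k<l , A<k , A∈C))

    induction : NaturalInduction Δ 𝒪
    induction = record
      { ordinals   = ordinals
      ; 𝔄          = Stage
      ; increasing = stage-increasing
      ; zero       = λ isZero A (A<i , _) → isZero [ A ] A<i
      ; successor  = λ (_ , j=i+1 , A∈j , A∉i) →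
          proj₂ (transfer (stage-agrees (new-below j=i+1 A∈j A∉i)))
                (supported (proj₂ A∈j))
      ; limitStage = λ isLimit →
          (λ A∈l → let (k , k<l , A∈k) = stage-limit isLimit A∈l
                   in (k , k<l) , A∈k)
        , (λ ((_ , k<l) , A∈k) → stage-increasing (inj₁ k<l) A∈k)
      }

    induction-terminal : induction ∈ Terminal Δ 𝒪
    induction-terminal A _ ⊩A =
        [ A ]<⊤⁺
      , saturated (proj₁ (transfer {A} (stage-agrees λ {B} _ → [ B ]<⊤⁺)) ⊩A)

    induction-respects : induction ∈ Respects Δ 𝒪 _≺_
    induction-respects i A (_ , j=i+1 , A∈j , A∉i) B B≺A ⊩B =
      let below-i = new-below j=i+1 A∈j A∉i in
        below-i B≺A
      , saturated (proj₁ (transfer (stage-agrees λ C≺B →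
                                      below-i (≺-trans C≺B B≺A))) ⊩B)

proposition3p39 : ∀ {ℓ} → ExcludedMiddle ℓ →
    (V : Vocabulary ℓ) (Δ : FormalDefinition V) (𝒪 : ContextStructure Δ)
    (_≺_ : Rel (At Δ 𝒪) ℓ) → StrictlyOrders Δ 𝒪 _≺_ →
    (∃ λ (𝒩 : NaturalInduction Δ 𝒪) →
    𝒩 ∈ Terminal Δ 𝒪 × 𝒩 ∈ Respects Δ 𝒪 _≺_)
    × (∀ (𝒩 𝒩′ : NaturalInduction Δ 𝒪) →
    𝒩 ∈ Terminal Δ 𝒪 → 𝒩 ∈ Respects Δ 𝒪 _≺_ →
    𝒩′ ∈ Terminal Δ 𝒪 → 𝒩′ ∈ Respects Δ 𝒪 _≺_ →
    NaturalInduction.limit 𝒩 ≐ NaturalInduction.limit 𝒩′)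
    × (∀ (_≺′_ : Rel (At Δ 𝒪) ℓ) → StrictlyOrders Δ 𝒪 _≺′_ →
    ∀ (𝒩 𝒩′ : NaturalInduction Δ 𝒪) →
    𝒩 ∈ Terminal Δ 𝒪 → 𝒩 ∈ Respects Δ 𝒪 _≺_ →
    𝒩′ ∈ Terminal Δ 𝒪 → 𝒩′ ∈ Respects Δ 𝒪 _≺′_ →
    NaturalInduction.limit 𝒩 ≐ NaturalInduction.limit 𝒩′)
proposition3p39 em V Δ 𝒪 _≺_ so =
    (induction , induction-terminal , induction-respects)
  , same-limit _≺_ so
  , same-limit
  where
  open Existence Δ 𝒪 em so
  open Dependency Δ 𝒪 so using (fixpoint-unique)
  open Limit Δ 𝒪 em using (limit-fixpoint)

  same-limit : ∀ _≺′_ → StrictlyOrders Δ 𝒪 _≺′_ → ∀ 𝒩 𝒩′ →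
    𝒩 ∈ Terminal Δ 𝒪 → 𝒩 ∈ Respects Δ 𝒪 _≺_ →
    𝒩′ ∈ Terminal Δ 𝒪 → 𝒩′ ∈ Respects Δ 𝒪 _≺′_ →
    NaturalInduction.limit 𝒩 ≐ NaturalInduction.limit 𝒩′
  same-limit _≺′_ so′ 𝒩 𝒩′ terminal respects terminal′ respects′ =
    fixpoint-unique (limit-fixpoint 𝒩 so terminal respects)
                    (limit-fixpoint 𝒩′ so′ terminal′ respects′)
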